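{- Let $\sigma=\{R\}$ with $R$ binary, and let $\Phi=\mathsf{Split}\vee\mathsf{Diverse}$ be the sentence defined in the context. Then $\Phi$ belongs to $\mathsf{FL}[0](\sigma)$, has quantifier rank three, and is preserved under extensions (if $\mathfrak C\subseteq\mathfrak D$ are $\sigma$-structures and $\mathfrak C\models\Phi$, then $\mathfrak D\models\Phi$), but there is no existential fluted sentence $\psi\in\exists\mathsf{FL}[0](\sigma)$ equivalent to $\Phi$ over all $\sigma$-structures. Consequently, the fragment-internal Łoś–Tarski theorem (``every fluted sentence preserved under extensions is equivalent to an existential fluted sentence'') fails already for the signature $\sigma=\{R\}$ consisting of a single binary relation symbol.
   Context: All structures have non-empty domains; there is no equality in the language. $\mathfrak C\subseteq\mathfrak D$ means that $\mathfrak C$ is the induced substructure of $\mathfrak D$ on $C\subseteq D$; then $\mathfrak D$ is an extension of $\mathfrak C$. Fluted fragment. Fix variables $x_1,x_2,\ldots$. For a finite signature $\sigma$ of relation symbols of positive arity, the levels $\mathsf{FL}[m](\sigma)$, $m\ge 0$, are defined by simultaneous induction: $\top,\bot\in\mathsf{FL}[m](\sigma)$; if $R\in\sigma$ has arity $r\le m$, then the suffix atom $R(x_{m-r+1},\ldots,x_m)$ is in $\mathsf{FL}[m](\sigma)$; $\mathsf{FL}[m](\sigma)$ is closed under $\neg,\wedge,\vee$; if $\varphi\in\mathsf{FL}[m+1](\sigma)$, then $\exists x_{m+1}\varphi,\forall x_{m+1}\varphi\in\mathsf{FL}[m](\sigma)$. $\mathsf{FL}[0](\sigma)$ is the set of fluted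 sentences. Quantifier rank is the usual one. The existential levels $\exists\mathsf{FL}[m](\sigma)$ are generated from permitted suffix atoms, negated suffix atoms and truth constants by $\wedge$, $\vee$ and existential quantification (if $\varphi\in\exists\mathsf{FL}[m+1](\sigma)$ then $\exists x_{m+1}\varphi\in\exists\mathsf{FL}[m](\sigma)$); no universal quantifiers. The sentence $\Phi$. Let $\mathsf Z(x_2):=\forall x_3\,\neg R(x_2,x_3)$, $\mathsf O(x_2):=\forall x_3\,R(x_2,x_3)$, $\mathsf M(x_2):=\exists x_3 R(x_2,x_3)\wedge\exists x_3\neg R(x_2,x_3)$, and $\mathsf M(x_1):=\exists x_2R(x_1,x_2)\wedge\exists x_2\neg R(x_1,x_2)$. For $\varepsilon\in\{0,1\}$ let $R^{1}(x_1,x_2):=R(x_1,x_2)$, $R^{0}(x_1,x_2):=\neg R(x_1,x_2)$, and for $T\in\{\mathsf Z,\mathsf O,\mathsf M\}$ let $E_{\varepsilon,T}(x_1):=\exists x_2(R^{\varepsilon}(x_1,x_2)\wedge T(x_2))$. Put $$\mathsf{Split}:=\bigvee_{T\in\{\mathsf Z,\mathsf O,\mathsf M\}}\exists x_1(E_{0,T}(x_1)\wedge E_{1,T}(x_1)),$$ $$\mathsf{Diverse}:=\bigvee_{\varepsilon\in\{0,1\},\,T\in\{\mathsf Z,\mathsf O,\mathsf M\}}\bigl[\exists x_1(\mathsf M(x_1)\wedge E_{\varepsilon,T}(x_1))\wedge\exists x_1(\mathsf M(x_1)\wedge\neg E_{\varepsilon,T}(x_1))\bigr],$$ $$\Phi:=\mathsf{Split}\vee\mathsf{Diverse}.$$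 -}

module Defs where

open import Data.Bool using (Bool; true; false; if_then_else_)
open import Data.Empty using (⊥)
open import Data.Fin using (Fin; zero; toℕ)
open import Data.List.NonEmpty using (List⁺; _∷_; foldr₁)
open import Data.List using ([]; _∷_)
open import Data.Nat using (ℕ; suc; _+_; _∸_; _⊔_; _≤_; _≟_; NonZero)
open import Data.Product using (Σ; ∃-syntax; _×_)
open import Data.Sum using (_⊎_)
open import Data.Unit using (⊤)
open import Data.Vec using (Vec; []; _∷_; map; tabulate)
open import Function.Bundles using (_↣_; _⇔_; module Injection)
open import Relation.Nullary using (¬_; does)

record Signature : Set where
  field
    size    : ℕ
    arity   : Fin size → ℕ
    arity>0 : ∀ R → NonZero (arity R)

  Symbol : Set
  Symbol = Fin size

open Signature public

-- First-order formulas without equality. The variable xᵢ is represented by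
-- the number i; indices start at 1 in fluted formulas, so 0 is never used.

infixr 7 _∧′_
infixr 6 _∨′_
infix  8 ¬′_

data Formula (σ : Signature) : Set where
  ⊤′ ⊥′     : Formula σ
  atom      : (R : Symbol σ) → Vec ℕ (arity σ R) → Formula σ
  ¬′_       : Formula σ → Formula σ
  _∧′_ _∨′_ : Formula σ → Formula σ → Formula σ
  ∃x ∀x     : ℕ → Formula σ → Formula σ

qr : ∀ {σ} → Formula σ → ℕ
qr ⊤′         = 0
qr ⊥′         = 0
qr (atom _ _) = 0
qr (¬′ φ)     = qr φ
qr (φ ∧′ ψ)   = qr φ ⊔ qr ψ
qr (φ ∨′ ψ)   = qr φ ⊔ qr ψ
qr (∃x _ φ)   = suc (qr φ)
qr (∀x _ φ)   = suc (qr φ)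

-- The variables x_{m-r+1}, …, x_m; only used for r ≤ m.
suffix : (m r : ℕ) → Vec ℕ r
suffix m r = tabulate λ i → suc (m ∸ r + toℕ i)

suffixAtom : ∀ {σ} → ℕ → Symbol σ → Formula σ
suffixAtom {σ} m R = atom R (suffix m (arity σ R))

infix 4 _∈FL[_] _∈∃FL[_]

data _∈FL[_] {σ : Signature} : Formula σ → ℕ → Set where
  top  : ∀ {m} → ⊤′ ∈FL[ m ]
  bot  : ∀ {m} → ⊥′ ∈FL[ m ]
  atom : ∀ {m} R → arity σ R ≤ m → suffixAtom m R ∈FL[ m ]
  neg  : ∀ {m φ} → φ ∈FL[ m ] → ¬′ φ ∈FL[ m ]
  conj : ∀ {m φ ψ} → φ ∈FL[ m ] → ψ ∈FL[ m ] → φ ∧′ ψ ∈FL[ m ]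
  disj : ∀ {m φ ψ} → φ ∈FL[ m ] → ψ ∈FL[ m ] → φ ∨′ ψ ∈FL[ m ]
  ex   : ∀ {m φ} → φ ∈FL[ suc m ] → ∃x (suc m) φ ∈FL[ m ]
  all  : ∀ {m φ} → φ ∈FL[ suc m ] → ∀x (suc m) φ ∈FL[ m ]

data _∈∃FL[_] {σ : Signature} : Formula σ → ℕ → Set where
  top   : ∀ {m} → ⊤′ ∈∃FL[ m ]
  bot   : ∀ {m} → ⊥′ ∈∃FL[ m ]
  atom  : ∀ {m} R → arity σ R ≤ m → suffixAtom m R ∈∃FL[ m ]
  ¬atom : ∀ {m} R → arity σ R ≤ m → ¬′ suffixAtom m R ∈∃FL[ m ]
  conj  : ∀ {m φ ψ} → φ ∈∃FL[ m ] → ψ ∈∃FL[ m ] → φ ∧′ ψ ∈∃FL[ m ]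
  disj  : ∀ {m φ ψ} → φ ∈∃FL[ m ] → ψ ∈∃FL[ m ] → φ ∨′ ψ ∈∃FL[ m ]
  ex    : ∀ {m φ} → φ ∈∃FL[ suc m ] → ∃x (suc m) φ ∈∃FL[ m ]

-- The field nonEmpty only witnesses that the domain has an element: it is not
-- interpreted by any symbol and substructures need not respect it.
record Structure (σ : Signature) : Set₁ where
  field
    Carrier  : Set
    nonEmpty : Carrier
    interp   : (R : Symbol σ) → Vec Carrier (arity σ R) → Set

open Structure public

_[_≔_] : {A : Set} → (ℕ → A) → ℕ → A → (ℕ → A)
(s [ i ≔ a ]) j = if does (i ≟ j) then a else s j

infix 4 _,_⊨_ _⊨_ _≋_

_,_⊨_ : ∀ {σ} (𝔄 : Structure σ) → (ℕ → Carrier 𝔄) → Formula σ → Set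
𝔄 , s ⊨ ⊤′        = ⊤
𝔄 , s ⊨ ⊥′        = ⊥
𝔄 , s ⊨ atom R xs = interp 𝔄 R (map s xs)
𝔄 , s ⊨ ¬′ φ      = ¬ (𝔄 , s ⊨ φ)
𝔄 , s ⊨ φ ∧′ ψ    = (𝔄 , s ⊨ φ) × (𝔄 , s ⊨ ψ)
𝔄 , s ⊨ φ ∨′ ψ    = (𝔄 , s ⊨ φ) ⊎ (𝔄 , s ⊨ ψ)
𝔄 , s ⊨ ∃x i φ    = Σ (Carrier 𝔄) λ a → 𝔄 , s [ i ≔ a ] ⊨ φ
𝔄 , s ⊨ ∀x i φ    = (a : Carrier 𝔄) → 𝔄 , s [ i ≔ a ] ⊨ φ

-- Only used for sentences, whose truth does not depend on the assignment.
_⊨_ : ∀ {σ} → Structure σ → Formula σ → Set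
𝔄 ⊨ φ = ∀ s → 𝔄 , s ⊨ φ

-- 𝔇 is an extension of ℭ: the domain of ℭ is included in that of 𝔇 by an
-- injection, and ℭ carries the induced structure.
record _⊑_ {σ : Signature} (ℭ 𝔇 : Structure σ) : Set where
  field
    inclusion : Carrier ℭ ↣ Carrier 𝔇
    induced   : ∀ R (cs : Vec (Carrier ℭ) (arity σ R)) →
                interp ℭ R cs ⇔ interp 𝔇 R (map (Injection.to inclusion) cs)

PreservedUnderExtensions : ∀ {σ} → Formula σ → Set₁
PreservedUnderExtensions {σ} φ =
  (ℭ 𝔇 : Structure σ) → ℭ ⊑ 𝔇 → ℭ ⊨ φ → 𝔇 ⊨ φ

_≋_ : ∀ {σ} → Formula σ → Formula σ → Set₁
_≋_ {σ} φ ψ = (𝔄 : Structure σ) → (𝔄 ⊨ φ) ⇔ (𝔄 ⊨ ψ)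

FragmentInternalŁośTarski : Signature → Set₁
FragmentInternalŁośTarski σ =
  (φ : Formula σ) → φ ∈FL[ 0 ] → PreservedUnderExtensions φ →
  ∃[ ψ ] ψ ∈∃FL[ 0 ] × φ ≋ ψ

σᴿ : Signature
σᴿ = record { size = 1 ; arity = λ _ → 2 ; arity>0 = λ _ → _ }

R : ℕ → ℕ → Formula σᴿ
R i j = atom zero (i ∷ j ∷ [])

R^ : Bool → ℕ → ℕ → Formula σᴿ
R^ true  i j = R i j
R^ false i j = ¬′ R i j

Z O : Formula σᴿ
Z = ∀x 3 (¬′ R 2 3)
O = ∀x 3 (R 2 3)

-- M i is 𝖬(xᵢ).
M : ℕ → Formula σᴿ
M i = ∃x (suc i) (R i (suc i)) ∧′ ∃x (suc i) (¬′ R i (suc i))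

-- The argument T is one of 𝖹(x₂), 𝖮(x₂), 𝖬(x₂).
E : Bool → Formula σᴿ → Formula σᴿ
E ε T = ∃x 2 (R^ ε 1 2 ∧′ T)

⋁ : List⁺ (Formula σᴿ) → Formula σᴿ
⋁ = foldr₁ _∨′_

Split : Formula σᴿ
Split = ⋁ (split Z ∷ split O ∷ split (M 2) ∷ [])
  where
  split : Formula σᴿ → Formula σᴿ
  split T = ∃x 1 (E false T ∧′ E true T)

Diverse : Formula σᴿ
Diverse = ⋁ ( diverse false Z ∷ diverse false O ∷ diverse false (M 2)
            ∷ diverse true  Z ∷ diverse true  O ∷ diverse true  (M 2) ∷ [])
  where
  diverse : Bool → Formula σᴿ → Formula σᴿ
  diverse ε T = ∃x 1 (M 1 ∧′ E ε T) ∧′ ∃x 1 (M 1 ∧′ ¬′ E ε T)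

Φ : Formula σᴿ
Φ = Split ∨′ Diverse

{-# OPTIONS --safe #-}
-- In a structure refuting Φ, whether R(x,y) holds depends only on the kinds
-- (zero, one or mixed row) of x and y. In a substructure all mixed elements of
-- the big structure still share one row, so they stay mixed together or become
-- constant together; in both cases Φ remains false.
--
-- Over {R} an existential fluted formula only inspects walks whose steps are
-- labelled R or ¬R, so it is preserved by simulations. The structure with the
-- single edge 0 → 1 on three points satisfies Φ (0 splits the zero rows 1 and 2)
-- and is simulated by the single edge on two points, where Φ fails.
module Submission where

open import Defs
open import Axiom.ExcludedMiddle using (ExcludedMiddle)
open import Data.Product using (∃-syntax; _×_)
open import Level using (0ℓ)
open import Relation.Binary.PropositionalEquality using (_≡_)
open import Relation.Nullary using (¬_)

open import Data.Bool using (Bool; true; false)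
open import Data.Empty using (⊥; ⊥-elim)
open import Data.Fin using (Fin; zero; suc)
open import Data.Nat using (ℕ; zero; suc; _+_; _≤_; z≤n; s≤s; _≟_)
open import Data.Nat.Properties using (+-comm; +-identityʳ; 1+n≢n)
open import Data.Product using (_,_; proj₁)
open import Data.Sum using (inj₁; inj₂; [_,_])
open import Data.Unit using (⊤; tt)
open import Data.Vec using ([]; _∷_)
open import Function using (_∘_; id; const; module Equivalence)
open import Function.Bundles using (_⇔_; mk⇔; module Injection)
open import Relation.Binary.PropositionalEquality using (_≢_; refl)
open import Relation.Nullary using (yes; no)
open import Relation.Nullary.Decidable using (decidable-stable; dec-true; dec-false)

open Equivalence using (to; from)

-- Semantic reading of `Split` and `Diverse`

Rel : (𝔄 : Structure σᴿ) → Carrier 𝔄 → Carrier 𝔄 → Set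
Rel 𝔄 x y = interp 𝔄 zero (x ∷ y ∷ [])

data Kind : Set where
  zeroRow oneRow mixedRow : Kind

module Semantics (𝔄 : Structure σᴿ) where

  Rel^ : Bool → Carrier 𝔄 → Carrier 𝔄 → Set
  Rel^ true  x y = Rel 𝔄 x y
  Rel^ false x y = ¬ Rel 𝔄 x y

  Mixed : Carrier 𝔄 → Set
  Mixed x = (∃[ y ] Rel 𝔄 x y) × (∃[ y ] ¬ Rel 𝔄 x y)

  HasKind : Kind → Carrier 𝔄 → Set
  HasKind zeroRow  x = ∀ y → ¬ Rel 𝔄 x y
  HasKind oneRow   x = ∀ y → Rel 𝔄 x y
  HasKind mixedRow x = Mixed x

  Sees : Bool → Kind → Carrier 𝔄 → Set
  Sees ε k x = ∃[ y ] Rel^ ε x y × HasKind k y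

  IsSplit : Set
  IsSplit = ∃[ k ] ∃[ x ] Sees false k x × Sees true k x

  IsDiverse : Set
  IsDiverse = ∃[ ε ] ∃[ k ] (∃[ x ] Mixed x × Sees ε k x)
                          × (∃[ x ] Mixed x × ¬ Sees ε k x)

  -- Satisfaction of each disjunct unfolds definitionally to `IsSplit` at one kind, so only the
  -- injections are translated.
  ⊨Split⇔ : ∀ s → (𝔄 , s ⊨ Split) ⇔ IsSplit
  ⊨Split⇔ s = mk⇔ fwd bwd
    where
    fwd : 𝔄 , s ⊨ Split → IsSplit
    fwd (inj₁ p)        = zeroRow  , p
    fwd (inj₂ (inj₁ p)) = oneRow   , p
    fwd (inj₂ (inj₂ p)) = mixedRow , p

    bwd : IsSplit → 𝔄 , s ⊨ Split
    bwd (zeroRow  , p) = inj₁ p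
    bwd (oneRow   , p) = inj₂ (inj₁ p)
    bwd (mixedRow , p) = inj₂ (inj₂ p)

  ⊨Diverse⇔ : ∀ s → (𝔄 , s ⊨ Diverse) ⇔ IsDiverse
  ⊨Diverse⇔ s = mk⇔ fwd bwd
    where
    fwd : 𝔄 , s ⊨ Diverse → IsDiverse
    fwd (inj₁ p)                             = false , zeroRow  , p
    fwd (inj₂ (inj₁ p))                      = false , oneRow   , p
    fwd (inj₂ (inj₂ (inj₁ p)))               = false , mixedRow , p
    fwd (inj₂ (inj₂ (inj₂ (inj₁ p))))        = true  , zeroRow  , p
    fwd (inj₂ (inj₂ (inj₂ (inj₂ (inj₁ p))))) = true  , oneRow   , p
    fwd (inj₂ (inj₂ (inj₂ (inj₂ (inj₂ p))))) = true  , mixedRow , p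

    bwd : IsDiverse → 𝔄 , s ⊨ Diverse
    bwd (false , zeroRow  , p) = inj₁ p
    bwd (false , oneRow   , p) = inj₂ (inj₁ p)
    bwd (false , mixedRow , p) = inj₂ (inj₂ (inj₁ p))
    bwd (true  , zeroRow  , p) = inj₂ (inj₂ (inj₂ (inj₁ p)))
    bwd (true  , oneRow   , p) = inj₂ (inj₂ (inj₂ (inj₂ (inj₁ p))))
    bwd (true  , mixedRow , p) = inj₂ (inj₂ (inj₂ (inj₂ (inj₂ p))))

open Semantics

-- Preservation under extensions

module _ (em : ExcludedMiddle 0ℓ) where

  kindOf : ∀ 𝔄 x → ∃[ k ] HasKind 𝔄 k x
  kindOf 𝔄 x with em {∃[ y ] Rel 𝔄 x y} | em {∃[ y ] ¬ Rel 𝔄 x y}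
  ... | no ¬∃R | _       = zeroRow  , λ y r → ¬∃R (y , r)
  ... | yes _  | no ¬∃¬R = oneRow   , λ y → decidable-stable em λ ¬r → ¬∃¬R (y , ¬r)
  ... | yes r  | yes ¬r  = mixedRow , r , ¬r

  ¬split⇒kind-determines : ∀ 𝔄 → ¬ IsSplit 𝔄 → ∀ {k x y y′} →
    HasKind 𝔄 k y → HasKind 𝔄 k y′ → Rel 𝔄 x y → Rel 𝔄 x y′
  ¬split⇒kind-determines 𝔄 ¬split hy hy′ r =
    decidable-stable em λ ¬r′ → ¬split (_ , _ , (_ , ¬r′ , hy′) , (_ , r , hy))

  -- Without diversity, `x′` has an `R`-successor of the same kind as `y`; without a split, the edge
  -- moves from that successor to `y` itself.
  mixed-same-row : ∀ 𝔄 → ¬ IsSplit 𝔄 → ¬ IsDiverse 𝔄 → ∀ {x x′} →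
    Mixed 𝔄 x → Mixed 𝔄 x′ → ∀ y → Rel 𝔄 x y → Rel 𝔄 x′ y
  mixed-same-row 𝔄 ¬split ¬diverse {x} {x′} mx mx′ y r with kindOf 𝔄 y
  ... | k , hy with em {Sees 𝔄 true k x′}
  ...   | yes (_ , r′ , hy′) = ¬split⇒kind-determines 𝔄 ¬split hy′ hy r′
  ...   | no ¬sees = ⊥-elim (¬diverse (true , k , (x , mx , y , r , hy) , (x′ , mx′ , ¬sees)))

  module _ {ℭ 𝔇 : Structure σᴿ} (ℭ⊑𝔇 : ℭ ⊑ 𝔇)
           (¬split : ¬ IsSplit 𝔇) (¬diverse : ¬ IsDiverse 𝔇) where

    private
      ι : Carrier ℭ → Carrier 𝔇
      ι = Injection.to (_⊑_.inclusion ℭ⊑𝔇)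

      Rel-ι : ∀ x y → Rel ℭ x y ⇔ Rel 𝔇 (ι x) (ι y)
      Rel-ι x y = _⊑_.induced ℭ⊑𝔇 zero (x ∷ y ∷ [])

    Mixed-ι : ∀ {x} → Mixed ℭ x → Mixed 𝔇 (ι x)
    Mixed-ι ((y , r) , (z , ¬r)) =
      (ι y , to (Rel-ι _ y) r) , (ι z , ¬r ∘ from (Rel-ι _ z))

    -- Mixedness is asked for in `𝔇` only, so this also covers elements whose row is constant in
    -- `ℭ`.
    ι-mixed-same-row : ∀ {x x′} → Mixed 𝔇 (ι x) → Mixed 𝔇 (ι x′) →
      ∀ y → Rel ℭ x y → Rel ℭ x′ y
    ι-mixed-same-row mx mx′ y =
      from (Rel-ι _ y) ∘ mixed-same-row 𝔇 ¬split ¬diverse mx mx′ (ι y) ∘ to (Rel-ι _ y)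

    -- In general a constant row may become mixed in an extension. A mixed `x` in `ℭ` prevents this:
    -- `y` would then share the row of `x`, which is already not constant on `ℭ`.
    HasKind-ι : ∀ {x} → Mixed ℭ x → ∀ k {y} → HasKind ℭ k y → HasKind 𝔇 k (ι y)
    HasKind-ι mx mixedRow hy = Mixed-ι hy
    HasKind-ι mx@((z , r) , _) zeroRow {y} hy with kindOf 𝔇 (ι y)
    ... | zeroRow  , h = h
    -- The diagonal pair at `y` lies in `ℭ` and tells empty rows from full ones.
    ... | oneRow   , h = ⊥-elim (hy y (from (Rel-ι y y) (h (ι y))))
    ... | mixedRow , h = ⊥-elim (hy z (ι-mixed-same-row (Mixed-ι mx) h z r))
    HasKind-ι mx@(_ , (z , ¬r)) oneRow {y} hy with kindOf 𝔇 (ι y)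
    ... | zeroRow  , h = ⊥-elim (h (ι y) (to (Rel-ι y y) (hy y)))
    ... | oneRow   , h = h
    ... | mixedRow , h = ⊥-elim (¬r (ι-mixed-same-row h (Mixed-ι mx) z (hy z)))

    -- A splitting element is itself mixed, so the kinds of its two successors carry over to `𝔇`,
    -- where no split exists.
    ¬IsSplit-⊑ : ¬ IsSplit ℭ
    ¬IsSplit-⊑ (k , x , (y , ¬r , hy) , (y′ , r , hy′)) =
      ¬r (from (Rel-ι x y) (¬split⇒kind-determines 𝔇 ¬split
            (HasKind-ι mx k hy′) (HasKind-ι mx k hy) (to (Rel-ι x y′) r)))
      where
      mx : Mixed ℭ x
      mx = (y′ , r) , (y , ¬r)

    ¬IsDiverse-⊑ : ¬ IsDiverse ℭ
    ¬IsDiverse-⊑ (true , _ , (x , mx , y , r , hy) , (x′ , mx′ , ¬sees)) =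
      ¬sees (y , ι-mixed-same-row (Mixed-ι mx) (Mixed-ι mx′) y r , hy)
    -- For non-edges the inclusion of rows is used in the opposite direction, from `x′` to `x`.
    ¬IsDiverse-⊑ (false , _ , (x , mx , y , ¬r , hy) , (x′ , mx′ , ¬sees)) =
      ¬sees (y , ¬r ∘ ι-mixed-same-row (Mixed-ι mx′) (Mixed-ι mx) y , hy)

  Φ-preserved : PreservedUnderExtensions Φ
  Φ-preserved ℭ 𝔇 ℭ⊑𝔇 ⊨Φ s = decidable-stable em λ ⊭Φ →
    let ¬split   = ⊭Φ ∘ inj₁ ∘ from (⊨Split⇔ 𝔇 s)
        ¬diverse = ⊭Φ ∘ inj₂ ∘ from (⊨Diverse⇔ 𝔇 s)
        -- Truth in `ℭ` quantifies over assignments; `nonEmpty` provides one to instantiate it.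
        s₀       = const (nonEmpty ℭ)
    in [ ¬IsSplit-⊑ ℭ⊑𝔇 ¬split ¬diverse ∘ to (⊨Split⇔ ℭ s₀)
       , ¬IsDiverse-⊑ ℭ⊑𝔇 ¬split ¬diverse ∘ to (⊨Diverse⇔ ℭ s₀) ] (⊨Φ s₀)

-- Simulations

-- There is no back condition, as universal quantifiers are absent. The equivalence on edges serves
-- negated atoms, and only the edge from the current element matters because atoms are suffixes.
record Simulation (𝔄 𝔅 : Structure σᴿ) : Set₁ where
  infix 4 _≼_
  field
    _≼_   : Carrier 𝔄 → Carrier 𝔅 → Set
    total : ∀ a → ∃[ b ] a ≼ b
    step  : ∀ {a b} → a ≼ b → ∀ a′ →
            ∃[ b′ ] a′ ≼ b′ × (Rel 𝔄 a a′ ⇔ Rel 𝔅 b b′)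

update-same : ∀ {A : Set} (s : ℕ → A) i a → (s [ i ≔ a ]) i ≡ a
update-same s i a rewrite dec-true (i ≟ i) refl = refl

update-other : ∀ {A : Set} (s : ℕ → A) {i j} a → i ≢ j → (s [ i ≔ a ]) j ≡ s j
update-other s {i} {j} a i≢j rewrite dec-false (i ≟ j) i≢j = refl

module _ {𝔄 𝔅 : Structure σᴿ} (sim : Simulation 𝔄 𝔅) where
  open Simulation sim

  -- All that a fluted formula of level m can see of an assignment.
  Matches : ℕ → (ℕ → Carrier 𝔄) → (ℕ → Carrier 𝔅) → Set
  Matches 0             s t = ⊤
  Matches 1             s t = s 1 ≼ t 1
  Matches (suc (suc k)) s t =
    s (2 + k) ≼ t (2 + k) ×
    (Rel 𝔄 (s (1 + k)) (s (2 + k)) ⇔ Rel 𝔅 (t (1 + k)) (t (2 + k)))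

  Matches⇒≼ : ∀ k {s t} → Matches (suc k) s t → s (suc k) ≼ t (suc k)
  Matches⇒≼ zero    = id
  Matches⇒≼ (suc k) = proj₁

  Matches-extend : ∀ m {s t} → Matches m s t → ∀ a →
    ∃[ b ] Matches (suc m) (s [ suc m ≔ a ]) (t [ suc m ≔ b ])
  Matches-extend zero    _ a = total a
  Matches-extend (suc k) {s} {t} matches a with step (Matches⇒≼ k matches) a
  ... | b , a≼b , same = b , extended
    where
    extended : Matches (2 + k) (s [ 2 + k ≔ a ]) (t [ 2 + k ≔ b ])
    extended
      rewrite update-same s (2 + k) a | update-same t (2 + k) b
            | update-other s {2 + k} {1 + k} a 1+n≢n
            | update-other t {2 + k} {1 + k} b 1+n≢n
      = a≼b , same

  Matches⇒atom⇔ : ∀ {m s t} → Matches m s t → 2 ≤ m →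
    (𝔄 , s ⊨ suffixAtom m zero) ⇔ (𝔅 , t ⊨ suffixAtom m zero)
  Matches⇒atom⇔ {suc (suc k)} (_ , same) (s≤s (s≤s z≤n))
    -- The suffix indices compute to `suc (k + 0)` and `suc (k + 1)`.
    rewrite +-identityʳ k | +-comm k 1 = same

  ∃FL-simulated : ∀ {m φ} → φ ∈∃FL[ m ] → ∀ {s t} → Matches m s t →
    𝔄 , s ⊨ φ → 𝔅 , t ⊨ φ
  ∃FL-simulated top              _  _        = tt
  ∃FL-simulated (atom zero 2≤m)  ms p        = to (Matches⇒atom⇔ ms 2≤m) p
  ∃FL-simulated (¬atom zero 2≤m) ms ¬p       = ¬p ∘ from (Matches⇒atom⇔ ms 2≤m)
  ∃FL-simulated (conj φ ψ)       ms (p , q)  = ∃FL-simulated φ ms p , ∃FL-simulated ψ ms q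
  ∃FL-simulated (disj φ ψ)       ms (inj₁ p) = inj₁ (∃FL-simulated φ ms p)
  ∃FL-simulated (disj φ ψ)       ms (inj₂ q) = inj₂ (∃FL-simulated ψ ms q)
  ∃FL-simulated (ex {m} φ)       ms (a , p)  =
    let b , ms′ = Matches-extend m ms a in b , ∃FL-simulated φ ms′ p

  ∃FL-sentence-simulated : ∀ {ψ} → ψ ∈∃FL[ 0 ] → 𝔄 ⊨ ψ → 𝔅 ⊨ ψ
  ∃FL-sentence-simulated ψ∈ ⊨ψ t = ∃FL-simulated ψ∈ {const (nonEmpty 𝔄)} tt (⊨ψ _)

-- Two structures separated by Φ

Edge : ∀ {n} → Fin (2 + n) → Fin (2 + n) → Set
Edge zero (suc zero) = ⊤
Edge _    _          = ⊥

singleEdge : ℕ → Structure σᴿ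
singleEdge n = record
  { Carrier  = Fin (2 + n)
  ; nonEmpty = zero
  ; interp   = λ { _ (x ∷ y ∷ []) → Edge x y }
  }

-- In the target, `zero` has both an edge and a non-edge, so it simulates every point: the edge is
-- answered by `suc zero`, every non-edge from `zero` by `zero` again.
singleEdge-sim : Simulation (singleEdge 1) (singleEdge 0)
singleEdge-sim = record { _≼_ = _≼_ ; total = λ a → zero , tt ; step = λ {a} {b} → step a b }
  where
  _≼_ : Fin 3 → Fin 2 → Set
  _     ≼ zero  = ⊤
  zero  ≼ suc _ = ⊥
  suc _ ≼ suc _ = ⊤

  step : ∀ a b → a ≼ b → ∀ a′ → ∃[ b′ ] a′ ≼ b′ × (Edge a a′ ⇔ Edge b b′)
  step zero    zero       _ zero             = zero , tt , mk⇔ id id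
  step zero    zero       _ (suc zero)       = suc zero , tt , mk⇔ id id
  step zero    zero       _ (suc (suc zero)) = zero , tt , mk⇔ id id
  step (suc _) zero       _ _                = zero , tt , mk⇔ (λ ()) (λ ())
  step (suc _) (suc zero) _ _                = zero , tt , mk⇔ (λ ()) (λ ())

singleEdge-1⊨Φ : singleEdge 1 ⊨ Φ
singleEdge-1⊨Φ s = inj₁ (from (⊨Split⇔ (singleEdge 1) s)
  (zeroRow , zero , (suc (suc zero) , (λ ()) , λ _ ()) , (suc zero , tt , λ _ ())))

-- Only `zero` has an outgoing edge. Its sole non-successor is itself, which is mixed, and its sole
-- successor has an empty row.
singleEdge-0-¬split : ¬ IsSplit (singleEdge 0)
singleEdge-0-¬split (_        , zero , (suc zero , ¬r , _) , (suc zero , _ , _))     = ¬r tt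
singleEdge-0-¬split (zeroRow  , zero , (zero , _ , h) , (suc zero , _ , _))          = h (suc zero) tt
singleEdge-0-¬split (oneRow   , zero , (zero , _ , _) , (suc zero , _ , h))          = h zero
singleEdge-0-¬split (mixedRow , zero , (zero , _ , _) , (suc zero , _ , (_ , ()) , _))

-- Only `zero` is mixed, so both witnesses coincide.
singleEdge-0-¬diverse : ¬ IsDiverse (singleEdge 0)
singleEdge-0-¬diverse (_ , _ , (zero , _ , sees) , (zero , _ , ¬sees)) = ¬sees sees
singleEdge-0-¬diverse (_ , _ , (suc _ , ((_ , ()) , _) , _) , _)
singleEdge-0-¬diverse (_ , _ , (zero , _) , (suc _ , ((_ , ()) , _) , _))

singleEdge-0⊭Φ : ¬ (singleEdge 0 ⊨ Φ)
singleEdge-0⊭Φ ⊨Φ =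
  [ singleEdge-0-¬split ∘ to (⊨Split⇔ (singleEdge 0) s₀)
  , singleEdge-0-¬diverse ∘ to (⊨Diverse⇔ (singleEdge 0) s₀) ] (⊨Φ s₀)
  where
  s₀ : ℕ → Fin 2
  s₀ = const zero

Φ-not-existential : ¬ (∃[ ψ ] ψ ∈∃FL[ 0 ] × Φ ≋ ψ)
Φ-not-existential (ψ , ψ∈ , Φ≋ψ) = singleEdge-0⊭Φ
  (from (Φ≋ψ (singleEdge 0))
    (∃FL-sentence-simulated singleEdge-sim ψ∈
      (to (Φ≋ψ (singleEdge 1)) singleEdge-1⊨Φ)))

-- Flutedness of `Φ` and assembly of the theorem

Φ∈FL : Φ ∈FL[ 0 ]
Φ∈FL = disj (disj (split Z∈) (disj (split O∈) (split M₂∈)))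
  (disj (diverse ¬R₁₂∈ Z∈) (disj (diverse ¬R₁₂∈ O∈) (disj (diverse ¬R₁₂∈ M₂∈)
  (disj (diverse R₁₂∈ Z∈) (disj (diverse R₁₂∈ O∈) (diverse R₁₂∈ M₂∈))))))
  where
  R₁₂∈ : R 1 2 ∈FL[ 2 ]
  R₁₂∈ = atom zero (s≤s (s≤s z≤n))

  ¬R₁₂∈ : ¬′ R 1 2 ∈FL[ 2 ]
  ¬R₁₂∈ = neg R₁₂∈

  R₂₃∈ : R 2 3 ∈FL[ 3 ]
  R₂₃∈ = atom zero (s≤s (s≤s z≤n))

  Z∈ : Z ∈FL[ 2 ]
  Z∈ = all (neg R₂₃∈)

  O∈ : O ∈FL[ 2 ]
  O∈ = all R₂₃∈

  M₁∈ : M 1 ∈FL[ 1 ]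
  M₁∈ = conj (ex R₁₂∈) (ex ¬R₁₂∈)

  M₂∈ : M 2 ∈FL[ 2 ]
  M₂∈ = conj (ex R₂₃∈) (ex (neg R₂₃∈))

  split : ∀ {T} → T ∈FL[ 2 ] → ∃x 1 (E false T ∧′ E true T) ∈FL[ 0 ]
  split T∈ = ex (conj (ex (conj ¬R₁₂∈ T∈)) (ex (conj R₁₂∈ T∈)))

  -- The literal `χ` stands for `R^ ε 1 2` at either label, so one derivation serves both.
  diverse : ∀ {χ T} → χ ∈FL[ 2 ] → T ∈FL[ 2 ] →
    ∃x 1 (M 1 ∧′ ∃x 2 (χ ∧′ T)) ∧′ ∃x 1 (M 1 ∧′ ¬′ ∃x 2 (χ ∧′ T)) ∈FL[ 0 ]
  diverse χ∈ T∈ =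
    let E∈ = ex (conj χ∈ T∈) in conj (ex (conj M₁∈ E∈)) (ex (conj M₁∈ (neg E∈)))

theorem4p8 : ExcludedMiddle 0ℓ →
    Φ ∈FL[ 0 ]
    × qr Φ ≡ 3
    × PreservedUnderExtensions Φ
    × ¬ (∃[ ψ ] ψ ∈∃FL[ 0 ] × Φ ≋ ψ)
    × ¬ FragmentInternalŁośTarski σᴿ
theorem4p8 em =
  Φ∈FL , refl , Φ-preserved em , Φ-not-existential ,
  λ łośTarski → Φ-not-existential (łośTarski Φ Φ∈FL (Φ-preserved em))
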